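{- For all Conway's games $x,y$, $$x\approx y\iff x\sim y .$$
   Context: Hypergames: work in a universe of possibly non-wellfounded sets (set theory with the Antifoundation Axiom, and the Axiom of Choice). The class $\mathcal H$ of hypergames (also called games) is the carrier of the final coalgebra $(\mathcal H,\mathrm{id})$ of the functor $F(A)=\mathcal P(A)\times\mathcal P(A)$ on the category of classes and functional classes, where $\mathcal P$ is the powerset functor. Thus a hypergame is a pair $x=(X^L,X^R)$ of sets of hypergames; elements $x^L\in X^L$ and $x^R\in X^R$ are the Left and Right options of $x$. Positions of $x$ are the hypergames hereditarily reachable from $x$. $0=(\emptyset,\emptyset)$. Conway's games are the well-founded hypergames, i.e. the elements of the carrier $\mathcal G$ of the initial algebra of $F$: inductively, if $X,X'\subseteq\mathcal G$ are sets then $(X,X')\in\mathcal G$. On Conway's games, define by induction $x\gtrsim y$ iff for all $x^R\in X^R$, $y\not\gtrsim x^R$, and for all $y^L\in Y^L$, $y^L\not\gtrsim x$. Define $x\sim y$ iff $x\gtrsim y$ and $y\gtrsim x$. Sum (on hypergames, defined coinductively): $x+y=(\{x^L+y\mid x^L\in X^L\}\cup\{x+y^L\mid y^L\in Y^L\},\ \{x^R+y\mid x^R\in X^R\}\cup\{x+y^R\mid y^R\in Y^R\})$. Plays: L (Left) and R (Right) move alternately; either may start. Player I is the one who starts, player II the other one; LI means L acting as player I, and similarly LII, RI, RII. A play on $x$ is a (possibly empty) finite or infinite sequence $x_1^{K_1}x_2^{K_2}\cdots$ with $K_i\in\{L,R\}$ and $K_{i+1}\neq K_i$, such that, with $x_0=x$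 and $x_i=(X_i^L,X_i^R)$, one has $x_{i+1}\in X_i^{K_{i+1}}$ for all $i\ge 0$. A finite play is winning for L (resp. R) if it ends with a position $y=(Y^L,Y^R)$ where R (resp. L) is next to move but $Y^R=\emptyset$ (resp. $Y^L=\emptyset$); the empty play ends at $x$ with the starting player next to move. Every infinite play is a draw. A play is non-losing for L (resp. R) if it is winning for L (resp. R) or is a draw. Strategies: for P in $\{$LI, LII, RI, RII$\}$ let $\mathrm{FPlay}^P_x$ be the set of finite plays on $x$ in which P has the prescribed role (first or second player) and is next to move (the empty play is included exactly when P is LI or RI). A strategy for P on $x$ is a partial function $f$ from $\mathrm{FPlay}^P_x$ to positions of $x$ such that $f(\pi)=x'$ implies that $\pi x'$ is a play, and $f(\pi)$ is defined whenever some $\pi x'$ is a play. The opponent of LI is RII, and of LII is RI (and conversely). A play $\pi$ is coherent with $f$ if for each proper prefix $\pi'$ of $\pi$ where P is next to move, $f(\pi')=x'$ implies $\pi'x'$ is a prefix of $\pi$. For a strategy $f$ for P and a strategy $f'$ for the opponent, $f*f'$ is the unique maximal play coherent with both. $f$ is non-losing for P if $f*f'$ is non-losing for P (i.e. for L or R accordingly) for every strategy $f'$ of the opponent. A strategy for L is a pair of strategies for LI and LII; for R, for RI and RII; for I, for LI and RI; for II, for LII and RII. Such a pair is non-losing if both components are. Equideterminacy: $x\Updownarrow y$ iff, for each player P in $\{$L, R, I, II$\}$, $x$ has a non-losing strategy for P if and only if $y$ does. Contextual equivalence: additive contexts are $C[\ ]::=[\ ]\mid C[\ ]+z\mid z+C[\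 ]$ with $z$ any hypergame; $x\approx y$ iff $C[x]\Updownarrow C[y]$ for every additive context $C[\ ]$. -}

module Defs where

open import Data.Empty.Polymorphic using (⊥)
open import Data.List using (List; []; _∷_; _∷ʳ_; length; applyUpTo)
open import Data.List.Relation.Binary.Pointwise using (Pointwise)
open import Data.List.Relation.Binary.Prefix.Heterogeneous using (Prefix)
open import Data.Maybe using (Maybe; just; Is-just)
import Data.Maybe.Relation.Binary.Pointwise as Maybe
open import Data.Nat using (ℕ)
open import Data.Product using (Σ; ∃; ∃-syntax; _×_; _,_; proj₁; proj₂)
open import Data.Sum using (_⊎_)
open import Data.Unit.Polymorphic using (⊤)
open import Function.Bundles using (_⇔_)
open import Induction.WellFounded using (Acc; acc)
open import Relation.Binary.PropositionalEquality using (_≡_)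
open import Relation.Nullary using (¬_)

data Side : Set where
  left right : Side

opp : Side → Side
opp left  = right
opp right = left

-- The final coalgebra of 𝒫 × 𝒫 is obtained as the class of all small pointed
-- coalgebras (a set of positions with its left and right edges, and a root),
-- with bisimilarity _≅_ as its equality: under Antifoundation every pointed
-- graph depicts exactly one hypergame, and two pointed graphs depict the same
-- hypergame exactly when they are bisimilar.  Positions need not all be
-- reachable from the root; unreachable ones do not affect the hypergame.

record Hypergame : Set₁ where
  field
    Position : Set
    _⟶[_]_   : Position → Side → Position → Set
    root     : Position

open Hypergame public using (Position; root)

Edge : (x : Hypergame) → Side → Position x → Position x → Set
Edge x K a b = Hypergame._⟶[_]_ x a K b

_at_ : (x : Hypergame) → Position x → Hypergame
x at a = record x { root = a }

infix 4 _≅_ _∈[_]_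

record _≅_ (x y : Hypergame) : Set₁ where
  field
    Rel   : Position x → Position y → Set
    roots : Rel (root x) (root y)
    forth : ∀ {a b K a′} → Rel a b → Edge x K a a′ → ∃[ b′ ] (Edge y K b b′ × Rel a′ b′)
    back  : ∀ {a b K b′} → Rel a b → Edge y K b b′ → ∃[ a′ ] (Edge x K a a′ × Rel a′ b′)

-- y ∈[ left ] x and y ∈[ right ] x say that y is an element of Xᴸ, resp. Xᴿ.

_∈[_]_ : Hypergame → Side → Hypergame → Set₁
y ∈[ K ] x = ∃[ a ] (Edge x K (root x) a × y ≅ (x at a))

-- In the product graph the game at (a , b) is (x at a) + (y at b): a move is
-- a move in exactly one of the two components.  This is the solution, unique
-- up to ≅, of the corecursive equation of the sum.

infixl 6 _+_

_+_ : Hypergame → Hypergame → Hypergame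
x + y = record
  { Position = Position x × Position y
  ; _⟶[_]_   = λ (a , b) K (a′ , b′) →
                 (Edge x K a a′ × b ≡ b′) ⊎ (a ≡ a′ × Edge y K b b′)
  ; root     = root x , root y
  }

-- Conway's games are the hypergames which are well-founded for the relation
-- of being an option.

_optionOf_ : Hypergame → Hypergame → Set₁
y optionOf x = ∃[ K ] (y ∈[ K ] x)

Conway : Hypergame → Set₁
Conway = Acc _optionOf_

𝒢 : Set₁
𝒢 = Σ Hypergame Conway

geq : ∀ {x y} → Conway x → Conway y → Set₁
geq {x} {y} (acc p) (acc q) =
    (∀ {xᴿ} (m : xᴿ ∈[ right ] x) → ¬ geq (acc q) (p (right , m)))
  × (∀ {yᴸ} (m : yᴸ ∈[ left ] y) → ¬ geq (q (left , m)) (acc p))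

infix 4 _≳_ _∼_

_≳_ : 𝒢 → 𝒢 → Set₁
(_ , p) ≳ (_ , q) = geq p q

_∼_ : 𝒢 → 𝒢 → Set₁
x ∼ y = (x ≳ y) × (y ≳ x)

-- A play is given by the sequence x₁ x₂ ⋯ of its positions together with the
-- side s which starts; since the players alternate, s determines the labels
-- Kᵢ.  turn s π is the side next to move after the finite play π.

turn : Side → List Hypergame → Side
turn s []      = s
turn s (_ ∷ π) = turn (opp s) π

end : Hypergame → List Hypergame → Hypergame
end x []      = x
end x (y ∷ π) = end y π

IsFinitePlay : Side → Hypergame → List Hypergame → Set₁
IsFinitePlay s x []      = ⊤
IsFinitePlay s x (y ∷ π) = (y ∈[ s ] x) × IsFinitePlay (opp s) y π

data Sequence : Set₁ where
  finite   : List Hypergame → Sequence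
  infinite : (ℕ → Hypergame) → Sequence

IsPlay : Side → Hypergame → Sequence → Set₁
IsPlay s x (finite π)   = IsFinitePlay s x π
IsPlay s x (infinite σ) = ∀ n → IsFinitePlay s x (applyUpTo σ n)

-- Prefixes, and the extension order on sequences, are taken up to ≅, the
-- equality of hypergames.

infix 4 _≼_ _⊑_

_≼_ : List Hypergame → Sequence → Set₁
π ≼ finite ρ   = Prefix _≅_ π ρ
π ≼ infinite σ = Pointwise _≅_ π (applyUpTo σ (length π))

_⊑_ : Sequence → Sequence → Set₁
p ⊑ q = ∀ π → π ≼ p → π ≼ q

Winning : Side → Side → Hypergame → Sequence → Set₁
Winning K s x (finite π)   = (turn s π ≡ opp K) × (∀ y → ¬ (y ∈[ opp K ] end x π))
Winning K s x (infinite σ) = ⊥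

Draw : Sequence → Set₁
Draw (finite π)   = ⊥
Draw (infinite σ) = ⊤

NonLosingPlay : Side → Side → Hypergame → Sequence → Set₁
NonLosingPlay K s x p = Winning K s x p ⊎ Draw p

-- Player I is the one who starts.

record Player : Set where
  constructor player
  field
    side    : Side
    starter : Side

open Player public

LI LII RI RII : Player
LI  = player left  left
LII = player left  right
RI  = player right right
RII = player right left

opponent : Player → Player
opponent (player K s) = player (opp K) s

record FPlay (P : Player) (x : Hypergame) : Set₁ where
  field
    moves  : List Hypergame
    isPlay : IsFinitePlay (starter P) x moves
    toMove : turn (starter P) moves ≡ side P

open FPlay public using (moves)

-- The field respects says that a strategy is a (partial) function on plays
-- with respect to ≅, i.e. does not depend on the graphs used to depict the
-- positions.

record Strategy (P : Player) (x : Hypergame) : Set₁ where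
  field
    choose   : FPlay P x → Maybe Hypergame
    respects : ∀ π ρ → Pointwise _≅_ (moves π) (moves ρ) →
               Maybe.Pointwise _≅_ (choose π) (choose ρ)
    legal    : ∀ π {y} → choose π ≡ just y → IsFinitePlay (starter P) x (moves π ∷ʳ y)
    defined  : ∀ π {y} → IsFinitePlay (starter P) x (moves π ∷ʳ y) → Is-just (choose π)

open Strategy public using (choose)

-- π is a proper prefix of p when some one-step extension π y is a prefix of p.

Coherent : ∀ {P x} → Sequence → Strategy P x → Set₁
Coherent {P} {x} p f =
  ∀ (π : FPlay P x) {y x′} → (moves π ∷ʳ y) ≼ p → choose f π ≡ just x′ → (moves π ∷ʳ x′) ≼ p

-- p Is f * f′: the maximal play coherent with both, which is unique up to ≅.

record _Is_*_ {P x} (p : Sequence) (f : Strategy P x) (f′ : Strategy (opponent P) x) : Set₁ where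
  field
    isPlay    : IsPlay (starter P) x p
    coherent  : Coherent p f
    coherent′ : Coherent p f′
    maximal   : ∀ q → IsPlay (starter P) x q → Coherent q f → Coherent q f′ → p ⊑ q → q ⊑ p

NonLosing : ∀ {P x} → Strategy P x → Set₁
NonLosing {P} {x} f =
  ∀ (f′ : Strategy (opponent P) x) p → p Is f * f′ → NonLosingPlay (side P) (starter P) x p

data Role : Set where
  L R I II : Role

components : Role → Player × Player
components L  = LI  , LII
components R  = RI  , RII
components I  = LI  , RI
components II = LII , RII

RoleStrategy : Role → Hypergame → Set₁
RoleStrategy Q x = Strategy (proj₁ (components Q)) x × Strategy (proj₂ (components Q)) x

HasNonLosingStrategy : Role → Hypergame → Set₁
HasNonLosingStrategy Q x = Σ (RoleStrategy Q x) λ (f , g) → NonLosing f × NonLosing g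

infix 4 _⇕_ _≈_

_⇕_ : Hypergame → Hypergame → Set₁
x ⇕ y = ∀ Q → HasNonLosingStrategy Q x ⇔ HasNonLosingStrategy Q y

data Context : Set₁ where
  hole : Context
  _+ʳ_ : Context → Hypergame → Context
  _+ˡ_ : Hypergame → Context → Context

_[_] : Context → Hypergame → Hypergame
hole [ x ]     = x
(C +ʳ z) [ x ] = (C [ x ]) + z
(z +ˡ C) [ x ] = z + (C [ x ])

_≈_ : Hypergame → Hypergame → Set₁
x ≈ y = ∀ C → (C [ x ]) ⇕ (C [ y ])

{-# OPTIONS --safe --termination-depth=2 #-}
module Submission where

-- A player has a non-losing strategy exactly when the opponent cannot force a
-- win in finitely many moves, so everything reduces to the inductive predicate
-- Lost.  If x ≥ y for a player, a forced win of that player on y + z carries over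
-- to x + z, for any hypergame z, by answering moves in x, and moves of the given
-- strategy in y, through the inequality.  This gives x ∼ y → x ≈ y.  Conversely the
-- context [ ] + - y separates: on y + - y the second player survives by mirroring,
-- whereas if an inequality between x and y fails, the first player can force a
-- win on x + - y.

open import Level using (0ℓ; suc)
open import Axiom.ExcludedMiddle using (ExcludedMiddle)
open import Axiom.Extensionality.Propositional using (Extensionality; lower-extensionality)
open import Data.Bool using (Bool; true)
open import Data.Empty using () renaming (⊥ to ∅)
open import Data.Empty.Polymorphic using (⊥)
open import Data.List using (List; []; _∷_; _∷ʳ_; _++_; length)
open import Data.List.Properties using (∷ʳ-++; ++-identityʳ)
open import Data.List.Relation.Binary.Pointwise as Pointwise using (Pointwise; []; _∷_)
open import Data.List.Relation.Binary.Prefix.Heterogeneous as Prefix using (Prefix; []; _∷_)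
import Data.List.Relation.Binary.Prefix.Heterogeneous.Properties as Prefix
open import Data.Maybe using (Maybe; just; nothing; Is-just)
import Data.Maybe.Relation.Binary.Pointwise as Maybe
import Data.Nat as ℕ
open import Data.Maybe.Relation.Unary.Any using (just)
open import Data.Product using (Σ; ∃-syntax; _×_; _,_; proj₁; proj₂)
open import Data.Sum using (_⊎_; inj₁; inj₂)
open import Data.Unit.Polymorphic using (⊤; tt)
open import Function.Base using (_∘_)
open import Function.Bundles using (_⇔_; mk⇔; Equivalence)
open import Induction.WellFounded using (acc)
open import Relation.Binary.PropositionalEquality using (_≡_; _≢_; refl; sym; trans; cong; subst; subst₂)
open import Relation.Nullary using (¬_; yes; no; does; contradiction)
open import Relation.Nullary.Decidable using (decidable-stable; dec-true; does-⇔)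
open import Defs

-- The two sides

opp-involutive : ∀ k → opp (opp k) ≡ k
opp-involutive left  = refl
opp-involutive right = refl

opp-irrefl : ∀ {k} → opp k ≢ k
opp-irrefl {left}  ()
opp-irrefl {right} ()

≡-or-opp : ∀ k t → t ≡ k ⊎ t ≡ opp k
≡-or-opp left  left  = inj₁ refl
≡-or-opp left  right = inj₂ refl
≡-or-opp right left  = inj₂ refl
≡-or-opp right right = inj₁ refl

-- Bisimilarity and membership

private variable
  k s t : Side
  u v w x y z : Hypergame
  π ρ : List Hypergame

≅-refl : x ≅ x
≅-refl = record
  { Rel   = _≡_
  ; roots = refl
  ; forth = λ { refl e → _ , e , refl }
  ; back  = λ { refl e → _ , e , refl }
  }

≅-sym : x ≅ y → y ≅ x
≅-sym B = record
  { Rel   = λ b a → _≅_.Rel B a b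
  ; roots = _≅_.roots B
  ; forth = _≅_.back B
  ; back  = _≅_.forth B
  }

≅-trans : x ≅ y → y ≅ z → x ≅ z
≅-trans B C = record
  { Rel   = λ a c → ∃[ b ] (B.Rel a b × C.Rel b c)
  ; roots = _ , B.roots , C.roots
  ; forth = λ (_ , r , r′) e →
      let _ , e′ , q  = B.forth r e
          _ , e″ , q′ = C.forth r′ e′
      in _ , e″ , _ , q , q′
  ; back  = λ (_ , r , r′) e →
      let _ , e′ , q  = C.back r′ e
          _ , e″ , q′ = B.back r e′
      in _ , e″ , _ , q′ , q
  }
  where
  module B = _≅_ B
  module C = _≅_ C

≅-at : (B : x ≅ y) → ∀ {a b} → _≅_.Rel B a b → (x at a) ≅ (y at b)
≅-at B r = record { Rel = _≅_.Rel B ; roots = r ; forth = _≅_.forth B ; back = _≅_.back B }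

∈-respʳ : x ≅ y → z ∈[ k ] x → z ∈[ k ] y
∈-respʳ B (_ , e , z≅) =
  let _ , e′ , r = _≅_.forth B (_≅_.roots B) e
  in _ , e′ , ≅-trans z≅ (≅-at B r)

∈-respˡ : y ≅ z → y ∈[ k ] x → z ∈[ k ] x
∈-respˡ B (_ , e , y≅) = _ , e , ≅-trans (≅-sym B) y≅

-- Sums

0ᴴ : Hypergame
0ᴴ = record { Position = ⊤ ; _⟶[_]_ = λ _ _ _ → ⊥ ; root = tt }

infix 8 -_

-_ : Hypergame → Hypergame
- x = record { Position = Position x ; _⟶[_]_ = λ a K b → Edge x (opp K) a b ; root = root x }

+-cong : x ≅ y → u ≅ v → x + u ≅ y + v
+-cong B C = record
  { Rel   = λ (a , b) (a′ , b′) → B.Rel a a′ × C.Rel b b′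
  ; roots = B.roots , C.roots
  ; forth = λ where
      (r , r′) (inj₁ (e , refl)) → let _ , e′ , q = B.forth r e in _ , inj₁ (e′ , refl) , q , r′
      (r , r′) (inj₂ (refl , e)) → let _ , e′ , q = C.forth r′ e in _ , inj₂ (refl , e′) , r , q
  ; back  = λ where
      (r , r′) (inj₁ (e , refl)) → let _ , e′ , q = B.back r e in _ , inj₁ (e′ , refl) , q , r′
      (r , r′) (inj₂ (refl , e)) → let _ , e′ , q = C.back r′ e in _ , inj₂ (refl , e′) , r , q
  }
  where
  module B = _≅_ B
  module C = _≅_ C

+-comm : ∀ x y → x + y ≅ y + x
+-comm x y = record
  { Rel   = λ (a , b) (b′ , a′) → a ≡ a′ × b ≡ b′
  ; roots = refl , refl
  ; forth = λ where
      (refl , refl) (inj₁ (e , refl)) → _ , inj₂ (refl , e) , refl , refl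
      (refl , refl) (inj₂ (refl , e)) → _ , inj₁ (e , refl) , refl , refl
  ; back  = λ where
      (refl , refl) (inj₁ (e , refl)) → _ , inj₂ (refl , e) , refl , refl
      (refl , refl) (inj₂ (refl , e)) → _ , inj₁ (e , refl) , refl , refl
  }

+-assoc : ∀ x y z → (x + y) + z ≅ x + (y + z)
+-assoc x y z = record
  { Rel   = λ ((a , b) , c) (a′ , (b′ , c′)) → a ≡ a′ × b ≡ b′ × c ≡ c′
  ; roots = refl , refl , refl
  ; forth = λ where
      (refl , refl , refl) (inj₁ (inj₁ (e , refl) , refl)) → _ , inj₁ (e , refl) , refl , refl , refl
      (refl , refl , refl) (inj₁ (inj₂ (refl , e) , refl)) → _ , inj₂ (refl , inj₁ (e , refl)) , refl , refl , refl
      (refl , refl , refl) (inj₂ (refl , e)) → _ , inj₂ (refl , inj₂ (refl , e)) , refl , refl , refl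
  ; back  = λ where
      (refl , refl , refl) (inj₁ (e , refl)) → _ , inj₁ (inj₁ (e , refl) , refl) , refl , refl , refl
      (refl , refl , refl) (inj₂ (refl , inj₁ (e , refl))) → _ , inj₁ (inj₂ (refl , e) , refl) , refl , refl , refl
      (refl , refl , refl) (inj₂ (refl , inj₂ (refl , e))) → _ , inj₂ (refl , e) , refl , refl , refl
  }

+-identityʳ : ∀ x → x + 0ᴴ ≅ x
+-identityʳ x = record
  { Rel   = λ (a , _) a′ → a ≡ a′
  ; roots = refl
  ; forth = λ { refl (inj₁ (e , refl)) → _ , e , refl ; refl (inj₂ (_ , ())) }
  ; back  = λ { refl e → _ , inj₁ (e , refl) , refl }
  }

+-optionˡ : y ∈[ k ] x → y + z ∈[ k ] x + z
+-optionˡ (_ , e , y≅) = _ , inj₁ (e , refl) , +-cong y≅ ≅-refl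

+-optionʳ : y ∈[ k ] z → x + y ∈[ k ] x + z
+-optionʳ (_ , e , y≅) = _ , inj₂ (refl , e) , +-cong ≅-refl y≅

+-option⁻ : w ∈[ k ] x + z →
            (∃[ y ] (y ∈[ k ] x × w ≅ y + z)) ⊎ (∃[ y ] (y ∈[ k ] z × w ≅ x + y))
+-option⁻ (_ , inj₁ (e , refl) , w≅) = inj₁ (_ , (_ , e , ≅-refl) , w≅)
+-option⁻ (_ , inj₂ (refl , e) , w≅) = inj₂ (_ , (_ , e , ≅-refl) , w≅)

-cong : x ≅ y → - x ≅ - y
-cong B = record { Rel = _≅_.Rel B ; roots = _≅_.roots B ; forth = _≅_.forth B ; back = _≅_.back B }

-‿option : y ∈[ k ] x → - y ∈[ opp k ] - x
-‿option {k = k} {x = x} (a , e , y≅) =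
  a , subst (λ K → Edge x K (root x) a) (sym (opp-involutive k)) e , -cong y≅

-‿option⁻ : w ∈[ k ] - x → ∃[ y ] (y ∈[ opp k ] x × w ≅ - y)
-‿option⁻ (a , e , w≅) = _ , (a , e , ≅-refl) , w≅

-- Commutativity and associativity collect the summands of a context into one `z`. It depends on `C`
-- alone, so the same `z` serves for both games under comparison.
context-as-sum : ∀ C → ∃[ z ] (∀ x → C [ x ] ≅ x + z)
context-as-sum hole     = 0ᴴ , λ x → ≅-sym (+-identityʳ x)
context-as-sum (C +ʳ w) =
  let z , C≅ = context-as-sum C
  in z + w , λ x → ≅-trans (+-cong (C≅ x) ≅-refl) (+-assoc x z w)
context-as-sum (w +ˡ C) =
  let z , C≅ = context-as-sum C
  in z + w , λ x → ≅-trans (+-comm w _) (≅-trans (+-cong (C≅ x) ≅-refl) (+-assoc x z w))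

-- Forced losses

-- Lost k t x: t is next to move and the opponent of k can force a win.

data Lost (k : Side) : Side → Hypergame → Set₁ where
  defend : (∀ {y} → y ∈[ k ] x → Lost k (opp k) y) → Lost k k x
  attack : y ∈[ opp k ] x → Lost k k y → Lost k (opp k) x

Survives : Player → Hypergame → Set₁
Survives P x = ¬ Lost (side P) (starter P) x

Lost-resp : x ≅ y → Lost k t x → Lost k t y
Lost-resp B (defend h)   = defend (h ∘ ∈-respʳ (≅-sym B))
Lost-resp B (attack m h) = attack (∈-respʳ B m) h

-- `k` answers each move by its mirror image in the other summand, which restores the form
-- `x + - x`. The induction is on the finite derivation of the loss. The side to move is a variable
-- with an equation because matching at the index `opp k` would leave `k` and `opp k` to be unified.
mirror-survives : Lost k t w → t ≡ opp k → w ≅ x + - x → ∅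
mirror-survives-reply : Lost k t w → t ≡ k → y ∈[ k ] w → y ≅ x + - x → ∅

mirror-survives (defend _) eq _ = opp-irrefl (sym eq)
mirror-survives {k} {x = x} (attack m l) _ w≅ with +-option⁻ (∈-respʳ w≅ m)
... | inj₁ (_ , (a , e , y≅) , w′≅) =
  mirror-survives-reply l refl
    (∈-respʳ (≅-sym w′≅) (+-optionʳ (a , e , ≅-refl))) (+-cong y≅ ≅-refl)
... | inj₂ (_ , m′ , w′≅) with -‿option⁻ m′
...   | _ , m″ , y≅ =
  mirror-survives-reply l refl
    (∈-respʳ (≅-sym w′≅) (+-optionˡ (subst (λ K → _ ∈[ K ] x) (opp-involutive k) m″)))
    (+-cong ≅-refl y≅)

mirror-survives-reply (defend h)   _  m = mirror-survives (h m) refl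
mirror-survives-reply (attack _ _) eq _ = contradiction eq opp-irrefl

-- The order on Conway's games

-- x ⊴[ k ] y: y is at least as good as x for k.

_⊴[_]_ : Conway x → Side → Conway y → Set₁
p ⊴[ left ]  q = geq q p
p ⊴[ right ] q = geq p q

-- The two clauses of `geq` change places when the sides are exchanged. Named relative to `k`, they
-- let the later arguments treat both sides at once.
⊴⇒option⋬ : ∀ k {p : ∀ {y} → y optionOf x → Conway y} {q : ∀ {y} → y optionOf z → Conway y} →
            acc p ⊴[ k ] acc q → (m : y ∈[ k ] x) → ¬ (acc q ⊴[ k ] p (k , m))
⊴⇒option⋬ left  (_ , h) = h
⊴⇒option⋬ right (h , _) = h

⊴⇒⋬option : ∀ k {p : ∀ {y} → y optionOf x → Conway y} {q : ∀ {y} → y optionOf z → Conway y} →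
            acc p ⊴[ k ] acc q → (m : y ∈[ opp k ] z) → ¬ (q (opp k , m) ⊴[ k ] acc p)
⊴⇒⋬option left  (h , _) = h
⊴⇒⋬option right (_ , h) = h

-- Plays

turn-∷ʳ : ∀ s π → turn s (π ∷ʳ y) ≡ opp (turn s π)
turn-∷ʳ s []      = refl
turn-∷ʳ s (_ ∷ π) = turn-∷ʳ (opp s) π

end-∷ʳ : ∀ π → end x (π ∷ʳ y) ≡ y
end-∷ʳ []      = refl
end-∷ʳ (_ ∷ π) = end-∷ʳ π

turn-cong : Pointwise _≅_ π ρ → turn s π ≡ turn s ρ
turn-cong []       = refl
turn-cong (_ ∷ rs) = turn-cong rs

end-cong : x ≅ y → Pointwise _≅_ π ρ → end x π ≅ end y ρ
end-cong B []       = B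
end-cong _ (B ∷ rs) = end-cong B rs

IsFinitePlay-∷ʳ⁺ : ∀ π → IsFinitePlay s x π → y ∈[ turn s π ] end x π → IsFinitePlay s x (π ∷ʳ y)
IsFinitePlay-∷ʳ⁺ []      _         m = m , tt
IsFinitePlay-∷ʳ⁺ (_ ∷ π) (m′ , pl) m = m′ , IsFinitePlay-∷ʳ⁺ π pl m

IsFinitePlay-∷ʳ⁻ : ∀ π → IsFinitePlay s x (π ∷ʳ y) → IsFinitePlay s x π × y ∈[ turn s π ] end x π
IsFinitePlay-∷ʳ⁻ []      (m , _)   = tt , m
IsFinitePlay-∷ʳ⁻ (_ ∷ π) (m′ , pl) = let pl′ , m = IsFinitePlay-∷ʳ⁻ π pl in (m′ , pl′) , m

IsFinitePlay-prefix : x ≅ y → Prefix _≅_ π ρ → IsFinitePlay s y ρ → IsFinitePlay s x π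
IsFinitePlay-prefix _ []       _        = tt
IsFinitePlay-prefix B (C ∷ rs) (m , pl) =
  ∈-respʳ (≅-sym B) (∈-respˡ (≅-sym C) m) , IsFinitePlay-prefix C rs pl

IsPlay-prefix : ∀ q → IsPlay s x q → π ≼ q → IsFinitePlay s x π
IsPlay-prefix (finite ρ)           pl π≼q = IsFinitePlay-prefix ≅-refl π≼q pl
IsPlay-prefix {π = π} (infinite σ) pl π≼q =
  IsFinitePlay-prefix ≅-refl (Prefix.fromPointwise π≼q) (pl (length π))

Pointwise-refl : Pointwise _≅_ π π
Pointwise-refl = Pointwise.refl ≅-refl

Pointwise-∷ʳ : Pointwise _≅_ π ρ → x ≅ y → Pointwise _≅_ (π ∷ʳ x) (ρ ∷ʳ y)
Pointwise-∷ʳ rs B = Pointwise.++⁺ rs (B ∷ [])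

Prefix-refl : Prefix _≅_ π π
Prefix-refl = Prefix.fromPointwise Pointwise-refl

Prefix-∷ʳ⁻ : ∀ π ρ → Prefix _≅_ (π ∷ʳ x) (ρ ∷ʳ y) →
             Prefix _≅_ (π ∷ʳ x) ρ ⊎ Pointwise _≅_ π ρ
Prefix-∷ʳ⁻ []          []      _        = inj₂ []
Prefix-∷ʳ⁻ []          (_ ∷ _) (B ∷ _)  = inj₁ (B ∷ [])
Prefix-∷ʳ⁻ (_ ∷ [])    []      (_ ∷ ())
Prefix-∷ʳ⁻ (_ ∷ _ ∷ _) []      (_ ∷ ())
Prefix-∷ʳ⁻ (_ ∷ π)     (_ ∷ ρ) (B ∷ rs) with Prefix-∷ʳ⁻ π ρ rs
... | inj₁ rs′ = inj₁ (B ∷ rs′)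
... | inj₂ rs′ = inj₂ (B ∷ rs′)

Prefix-∷ʳ-irrefl : ∀ π → ¬ Prefix _≅_ (π ∷ʳ x) π
Prefix-∷ʳ-irrefl (_ ∷ π) (_ ∷ rs) = Prefix-∷ʳ-irrefl π rs

Prefix-∷ʳ-unique : ∀ π → Prefix _≅_ (π ∷ʳ x) ρ → Prefix _≅_ (π ∷ʳ y) ρ → x ≅ y
Prefix-∷ʳ-unique []      (B ∷ _)  (C ∷ _)   = ≅-trans B (≅-sym C)
Prefix-∷ʳ-unique (_ ∷ π) (_ ∷ rs) (_ ∷ rs′) = Prefix-∷ʳ-unique π rs rs′

≼-comparable : ∀ q π ρ → π ≼ q → ρ ≼ q → Prefix _≅_ π ρ ⊎ ∃[ y ] Prefix _≅_ (ρ ∷ʳ y) π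
≼-comparable q            []      _       _        _  = inj₁ []
≼-comparable q            (y ∷ _) []      _        _  = inj₂ (y , ≅-refl ∷ [])
≼-comparable (finite (_ ∷ τ)) (_ ∷ π) (_ ∷ ρ) (B ∷ rs) (C ∷ rs′)
  with ≼-comparable (finite τ) π ρ rs rs′
... | inj₁ h       = inj₁ (≅-trans B (≅-sym C) ∷ h)
... | inj₂ (y , h) = inj₂ (y , ≅-trans C (≅-sym B) ∷ h)
≼-comparable (infinite σ) (_ ∷ π) (_ ∷ ρ) (B ∷ rs) (C ∷ rs′)
  with ≼-comparable (infinite (σ ∘ ℕ.suc)) π ρ rs rs′
... | inj₁ h       = inj₁ (≅-trans B (≅-sym C) ∷ h)
... | inj₂ (y , h) = inj₂ (y , ≅-trans C (≅-sym B) ∷ h)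

-- Coherence

private variable
  P : Player

FPlay-of : ∀ P → IsFinitePlay (starter P) x π → turn (starter P) π ≡ side P → FPlay P x
FPlay-of {π = π} P pl eq = record { moves = π ; isPlay = pl ; toMove = eq }

Is-just⇒≡just : {A : Set₁} {m : Maybe A} → Is-just m → ∃[ a ] m ≡ just a
Is-just⇒≡just (just _) = _ , refl

choice : (f : Strategy P x) (π : FPlay P x) → y ∈[ side P ] end x (moves π) →
         ∃[ z ] (choose f π ≡ just z)
choice {x = x} {y = y} f π m = Is-just⇒≡just (Strategy.defined f π
  (IsFinitePlay-∷ʳ⁺ (moves π) (FPlay.isPlay π)
    (subst (λ K → y ∈[ K ] end x (moves π)) (sym (FPlay.toMove π)) m)))

-- Only a constraint at the full length of `π` is new. There `ρ` is bisimilar to `π`, so `respects`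
-- makes the two choices agree.
Coherent-choice : (f : Strategy P x) (π : FPlay P x) → choose f π ≡ just y →
                  Coherent (finite (moves π)) f → Coherent (finite (moves π ∷ʳ y)) f
Coherent-choice f π eq coh ρ ρz≼ eq′ with Prefix-∷ʳ⁻ (moves ρ) (moves π) ρz≼
... | inj₁ ρz≼π = coh ρ ρz≼π eq′ Prefix.++ᵖ _
... | inj₂ ρ≅π with Maybe.drop-just (subst₂ (Maybe.Pointwise _≅_) eq′ eq (Strategy.respects f ρ π ρ≅π))
...   | B = Prefix.fromPointwise (Pointwise-∷ʳ ρ≅π B)

-- The added move belongs to the opponent, so `f` imposes no new constraint.
Coherent-other : (f : Strategy P x) → turn (starter P) π ≢ side P →
                 Coherent (finite π) f → Coherent (finite (π ∷ʳ y)) f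
Coherent-other {π = π} f other coh ρ ρz≼ eq with Prefix-∷ʳ⁻ (moves ρ) π ρz≼
... | inj₁ ρz≼π = coh ρ ρz≼π eq Prefix.++ᵖ _
... | inj₂ ρ≅π  = contradiction (trans (sym (turn-cong ρ≅π)) (FPlay.toMove ρ)) other

Is-*-unextendable : {f : Strategy P x} {f′ : Strategy (opponent P) x} → finite π Is f * f′ →
                    IsFinitePlay (starter P) x (π ∷ʳ y) →
                    Coherent (finite (π ∷ʳ y)) f → ¬ Coherent (finite (π ∷ʳ y)) f′
Is-*-unextendable {π = π} {y = y} is pl coh coh′ = Prefix-∷ʳ-irrefl π
  (_Is_*_.maximal is (finite (π ∷ʳ y)) pl coh coh′ (λ _ ρ≼π → ρ≼π Prefix.++ᵖ _) _ Prefix-refl)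

-- If the side to move had an option, its strategy would choose one. The play extended by that
-- choice would be coherent with both strategies, against maximality.
Is-*-stuck : {f : Strategy P x} {f′ : Strategy (opponent P) x} → finite π Is f * f′ →
             y ∈[ k ] end x π → turn (starter P) π ≢ k
Is-*-stuck {P} {x} {π} {k = k} {f} {f′} is m refl with ≡-or-opp (side P) k
... | inj₁ eq = Is-*-unextendable is (Strategy.legal f π′ z≡)
    (Coherent-choice f π′ z≡ coherent)
    (Coherent-other f′ (λ eq′ → opp-irrefl (trans (sym eq′) eq)) coherent′)
  where
  open _Is_*_ is
  π′ = FPlay-of P isPlay eq
  z≡ = proj₂ (choice f π′ (subst (λ K → _ ∈[ K ] end x π) eq m))
... | inj₂ eq = Is-*-unextendable is (Strategy.legal f′ π′ z≡)
    (Coherent-other f (λ eq′ → opp-irrefl (trans (sym eq) eq′)) coherent)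
    (Coherent-choice f′ π′ z≡ coherent′)
  where
  open _Is_*_ is
  π′ = FPlay-of (opponent P) isPlay eq
  z≡ = proj₂ (choice f′ π′ (subst (λ K → _ ∈[ K ] end x π) eq m))

-- Classical logic

module _ (em : ExcludedMiddle (suc 0ℓ)) where

  stable : {A : Set₁} → ¬ ¬ A → A
  stable = decidable-stable em

  -- Forced wins along the order

  ⋬⇒option : ∀ k {p : ∀ {y} → y optionOf x → Conway y} {q : ∀ {y} → y optionOf z → Conway y} →
    ¬ (acc p ⊴[ k ] acc q) →
      (∃[ y ] Σ (y ∈[ k ] x) λ m → acc q ⊴[ k ] p (k , m))
    ⊎ (∃[ y ] Σ (y ∈[ opp k ] z) λ m → q (opp k , m) ⊴[ k ] acc p)
  -- If no option refuted the inequality, both of its universal clauses would hold.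
  ⋬⇒option left  n = stable λ h → n ((λ m b → h (inj₂ (_ , m , b))) , (λ m b → h (inj₁ (_ , m , b))))
  ⋬⇒option right n = stable λ h → n ((λ m b → h (inj₁ (_ , m , b))) , (λ m b → h (inj₂ (_ , m , b))))

  -- Moves in `z` are copied between the two sums; a move of `k` in `x`, or of the opponent in `y`,
  -- leads to `Lost-attack`. Each call shortens the derivation of `Lost`, or keeps it and passes to
  -- an option of `x`, so `z` may be non-wellfounded.
  Lost-antitone : (p : Conway x) (q : Conway y) → p ⊴[ k ] q →
                  Lost k t w → w ≅ y + z → Lost k t (x + z)
  -- The two sums are out of step here: `k` is to move in `y + z`, the opponent in `x + z`. The
  -- option witnessing the failed inequality brings them back into step.
  Lost-attack : (p : Conway x) (q : Conway y) → ¬ (q ⊴[ k ] p) →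
                Lost k t w → t ≡ k → w ≅ y + z → Lost k (opp k) (x + z)

  Lost-antitone {x} {y} {k} {z = z} (acc p) (acc q) p⊴q l@(defend h) w≅ = defend reply
    where
    reply : u ∈[ k ] x + z → Lost k (opp k) u
    reply m with +-option⁻ m
    ... | inj₁ (_ , m′ , u≅) = Lost-resp (≅-sym u≅)
      (Lost-attack (p (k , m′)) (acc q) (⊴⇒option⋬ k p⊴q m′) l refl w≅)
    ... | inj₂ (_ , m′ , u≅) = Lost-resp (≅-sym u≅)
      (Lost-antitone (acc p) (acc q) p⊴q (h (∈-respʳ (≅-sym w≅) (+-optionʳ m′))) ≅-refl)
  Lost-antitone {k = k} (acc p) (acc q) p⊴q (attack m l) w≅ with +-option⁻ (∈-respʳ w≅ m)
  ... | inj₁ (_ , m′ , w′≅) = Lost-attack (acc p) (q (opp k , m′)) (⊴⇒⋬option k p⊴q m′) l refl w′≅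
  ... | inj₂ (_ , m′ , w′≅) = attack (+-optionʳ m′) (Lost-antitone (acc p) (acc q) p⊴q l w′≅)

  Lost-attack {k = k} (acc p) (acc q) q⋬p l@(defend h) _ w≅ with ⋬⇒option k q⋬p
  -- An imagined move of `k` in `y`: the forced win on `y + z` covers it, and nothing is played in
  -- `x + z`.
  ... | inj₁ (_ , m , p⊴y′) = Lost-antitone (acc p) (q (k , m)) p⊴y′ (h (∈-respʳ (≅-sym w≅) (+-optionˡ m))) ≅-refl
  -- A real move of the opponent in `x`, while `y + z` stands still.
  ... | inj₂ (_ , m , x′⊴q) = attack (+-optionˡ m) (Lost-antitone (p (opp k , m)) (acc q) x′⊴q l w≅)
  Lost-attack _ _ _ (attack _ _) eq _ = contradiction eq opp-irrefl

  -- Any move of `k`, in `x` or in `- y`, destroys the inequality. The option witnessing the failure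
  -- is then the opponent's winning answer, and it restores an inequality.
  ⊴⇒Lost-difference : (p : Conway x) (q : Conway y) → p ⊴[ k ] q → Lost k k (x + - y)
  ⋬⇒Lost-difference : (p : Conway x) (q : Conway y) → ¬ (q ⊴[ k ] p) → Lost k (opp k) (x + - y)

  ⊴⇒Lost-difference {x} {y} {k} (acc p) (acc q) p⊴q = defend reply
    where
    reply : u ∈[ k ] x + - y → Lost k (opp k) u
    reply m with +-option⁻ m
    ... | inj₁ (_ , m′ , u≅) = Lost-resp (≅-sym u≅)
      (⋬⇒Lost-difference (p (k , m′)) (acc q) (⊴⇒option⋬ k p⊴q m′))
    ... | inj₂ (_ , m′ , u≅) with -‿option⁻ m′
    ...   | _ , m″ , v≅ = Lost-resp (≅-sym (≅-trans u≅ (+-cong ≅-refl v≅)))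
      (⋬⇒Lost-difference (acc p) (q (opp k , m″)) (⊴⇒⋬option k p⊴q m″))

  ⋬⇒Lost-difference {k = k} (acc p) (acc q) q⋬p with ⋬⇒option k q⋬p
  ... | inj₁ (_ , m , p⊴y′) =
    attack (+-optionʳ (-‿option m)) (⊴⇒Lost-difference (acc p) (q (k , m)) p⊴y′)
  ... | inj₂ (_ , m , x′⊴q) =
    attack (+-optionˡ m) (⊴⇒Lost-difference (p (opp k , m)) (acc q) x′⊴q)

  -- From forced losses to plays

  ¬Lost⇒move : ¬ Lost k k x → ∃[ y ] (y ∈[ k ] x × ¬ Lost k (opp k) y)
  ¬Lost⇒move n = stable λ h → n (defend λ m → stable λ l → h (_ , m , l))

  -- The play `π` is continued with the choices of `f` and with the opponent's moves from the
  -- derivation of `Lost`. As the derivation is well-founded, this stops, with `P` to move and no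
  -- option left.
  lost-play : (f : Strategy P x) → IsFinitePlay (starter P) x π → Coherent (finite π) f →
              Lost (side P) t z → t ≡ turn (starter P) π → z ≡ end x π →
              ∃[ ρ ] (IsFinitePlay (starter P) x ρ × Coherent (finite ρ) f ×
                      turn (starter P) ρ ≡ side P × (∀ y → ¬ (y ∈[ side P ] end x ρ)))
  lost-play {P} {x} {π} f pl coh (defend h) eq refl with em {∃[ y ] (y ∈[ side P ] end x π)}
  ... | no n        = π , pl , coh , sym eq , λ y m → n (y , m)
  ... | yes (_ , m) with choice f (FPlay-of P pl (sym eq)) m
  ...   | z , z≡ = lost-play f (Strategy.legal f π′ z≡) (Coherent-choice f π′ z≡ coh)
    (h (subst (λ K → z ∈[ K ] end x π) (sym eq) (proj₂ (IsFinitePlay-∷ʳ⁻ π (Strategy.legal f π′ z≡)))))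
    (trans (cong opp eq) (sym (turn-∷ʳ (starter P) π))) (sym (end-∷ʳ π))
    where π′ = FPlay-of P pl (sym eq)
  lost-play {P} {x} {π} f pl coh (attack m l) eq refl =
    lost-play f (IsFinitePlay-∷ʳ⁺ π pl (subst (λ K → _ ∈[ K ] end x π) eq m))
      (Coherent-other f (λ eq′ → opp-irrefl (trans eq eq′)) coh)
      l (trans (sym (opp-involutive (side P))) (trans (cong opp eq) (sym (turn-∷ʳ (starter P) π))))
      (sym (end-∷ʳ π))

  -- Strategies obtained by choice

  module _ (ext : Extensionality (suc 0ℓ) (suc 0ℓ)) where

    -- em yields a choice function on truth-valued predicates, and by ext such a choice
    -- depends on the extension of the predicate only.
    pick : (Hypergame → Bool) → Maybe Hypergame
    pick φ with em {∃[ y ] φ y ≡ true}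
    ... | yes (y , _) = just y
    ... | no  _       = nothing

    pick-true : ∀ φ → pick φ ≡ just y → φ y ≡ true
    pick-true φ eq with em {∃[ y ] φ y ≡ true}
    pick-true φ refl | yes (_ , h) = h

    pick-just : ∀ φ → φ y ≡ true → Is-just (pick φ)
    pick-just φ h with em {∃[ y ] φ y ≡ true}
    ... | yes _ = just _
    ... | no  n = contradiction (_ , h) n

    select : (Hypergame → Set₁) → Maybe Hypergame
    select A = pick λ y → does (em {A y})

    private variable
      A B : Hypergame → Set₁

    select-sound : select A ≡ just y → A y
    select-sound {A} {y} eq with em {A y} | pick-true _ eq
    ... | yes a | _ = a

    select-just : A y → Is-just (select A)
    select-just {A} {y} a = pick-just _ (dec-true em a)

    select-cong : (∀ y → A y → B y) → (∀ y → B y → A y) → select A ≡ select B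
    select-cong A⊆B B⊆A = cong pick (lower-extensionality 0ℓ (suc 0ℓ) ext λ y →
      does-⇔ (mk⇔ (A⊆B y) (B⊆A y)) em em)

    -- A strategy that follows the advice `Good`. It serves twice: to avoid lost positions, and to
    -- steer along a given play.
    module Advised (P : Player) (x : Hypergame) (Good : List Hypergame → Hypergame → Set₁)
      (Good-cong : ∀ {π ρ y} → Pointwise _≅_ π ρ → Good π y → Good ρ y) where

      -- Where no option is good, every option is preferred. Thus a preferred option exists wherever
      -- an option does, as `defined` requires.
      Preferred : List Hypergame → Hypergame → Set₁
      Preferred π y = y ∈[ side P ] end x π × (∃[ z ] (z ∈[ side P ] end x π × Good π z) → Good π y)

      Preferred-cong : Pointwise _≅_ π ρ → ∀ y → Preferred π y → Preferred ρ y
      Preferred-cong rs y (m , h) = ∈-respʳ E m , λ (z , m′ , g) →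
        Good-cong rs (h (z , ∈-respʳ (≅-sym E) m′ , Good-cong (Pointwise.symmetric ≅-sym rs) g))
        where E = end-cong ≅-refl rs

      preferred : y ∈[ side P ] end x π → ∃[ z ] Preferred π z
      preferred {y} {π} m with em {∃[ z ] (z ∈[ side P ] end x π × Good π z)}
      ... | yes (z , m′ , g) = z , m′ , λ _ → g
      ... | no  n            = y , m , λ h → contradiction h n

      strategy : Strategy P x
      strategy = record
        { choose   = λ π → select (Preferred (moves π))
        ; respects = λ π ρ rs → subst (Maybe.Pointwise _≅_ (select (Preferred (moves π))))
            (select-cong (Preferred-cong rs) (Preferred-cong (Pointwise.symmetric ≅-sym rs)))
            (Maybe.refl ≅-refl)
        ; legal    = λ π eq → IsFinitePlay-∷ʳ⁺ (moves π) (FPlay.isPlay π)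
            (subst (λ K → _ ∈[ K ] end x (moves π)) (sym (FPlay.toMove π)) (proj₁ (select-sound eq)))
        ; defined  = λ π {y} pl → select-just (proj₂ (preferred
            (subst (λ K → y ∈[ K ] end x (moves π)) (FPlay.toMove π)
              (proj₂ (IsFinitePlay-∷ʳ⁻ (moves π) pl)))))
        }

      choose-good : ∀ (π : FPlay P x) {z} → choose strategy π ≡ just y →
                    z ∈[ side P ] end x (moves π) → Good (moves π) z → Good (moves π) y
      choose-good π eq m g = proj₂ (select-sound eq) (_ , m , g)

    -- The strategy keeps to positions that are not lost. In such a position with `P` to move there
    -- is an option, so a finite maximal play can end only with the opponent to move and stuck;
    -- infinite plays are draws.
    survives⇒nonLosing : Survives P x → ∃[ f ] NonLosing {P} {x} f
    survives⇒nonLosing {P@(player k s)} {x} survives = strategy , nonLosing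
      where
      open Advised P x (λ _ y → ¬ Lost k (opp k) y) (λ _ n → n)

      -- Induction on the remaining moves `ρ`. Coherence is kept for the whole play `p`, so it need
      -- not be derived again for each prefix.
      persists : ∀ {p} → IsPlay s x (finite p) → Coherent (finite p) strategy →
                 ∀ π ρ → π ++ ρ ≡ p → ¬ Lost k (turn s π) (end x π) → ¬ Lost k (turn s p) (end x p)
      persists pl coh π [] refl n rewrite ++-identityʳ π = n
      persists {p} pl coh π (y ∷ ρ) eq n = persists pl coh (π ∷ʳ y) ρ eq′
        (λ l → next (subst₂ (Lost k) (turn-∷ʳ s π) (end-∷ʳ π) l))
        where
        eq′ = trans (∷ʳ-++ π y ρ) eq
        πy≼p : Prefix _≅_ (π ∷ʳ y) p
        πy≼p = subst (Prefix _≅_ _) eq′ (Prefix-refl Prefix.++ᵖ ρ)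
        πy-play = IsFinitePlay-∷ʳ⁻ π (IsFinitePlay-prefix ≅-refl πy≼p pl)
        next : ¬ Lost k (opp (turn s π)) y
        next l with ≡-or-opp k (turn s π)
        -- By coherence the move `y` is, up to bisimilarity, the choice of the strategy, which is
        -- not lost since some option is not.
        ... | inj₁ eq =
          let πᴾ         = FPlay-of P (proj₁ πy-play) eq
              _ , m , ok = ¬Lost⇒move (subst (λ K → ¬ Lost k K (end x π)) eq n)
              _ , z≡     = choice strategy πᴾ m
              z≅y        = Prefix-∷ʳ-unique π (coh πᴾ πy≼p z≡) πy≼p
          in choose-good πᴾ z≡ m ok (Lost-resp (≅-sym z≅y) (subst (λ K → Lost k (opp K) y) eq l))
        -- A move of the opponent to a lost position would make the present position lost by
        -- `attack`.
        ... | inj₂ eq = n (subst (λ K → Lost k K (end x π)) (sym eq)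
          (attack (subst (λ K → y ∈[ K ] end x π) eq (proj₂ πy-play))
            (subst (λ K → Lost k K y) (trans (cong opp eq) (opp-involutive k)) l)))

      nonLosing : NonLosing strategy
      nonLosing f′ (infinite _) _  = inj₂ tt
      nonLosing f′ (finite p)   is = inj₁ (toMove , λ y m → Is-*-stuck is m toMove)
        where
        open _Is_*_ is
        toMove : turn s p ≡ opp k
        toMove with ≡-or-opp k (turn s p)
        ... | inj₂ eq = eq
        ... | inj₁ eq =
          let _ , m , _ = ¬Lost⇒move (subst (λ K → ¬ Lost k K (end x p)) eq
                            (persists isPlay coherent [] p refl survives))
          in contradiction eq (Is-*-stuck is m)

    -- From a lost position `lost-play` gives a play against `f` on which `P` gets stuck. An
    -- opponent who follows it makes it the outcome, so `f` loses.
    nonLosing⇒survives : (f : Strategy P x) → NonLosing f → Survives P x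
    nonLosing⇒survives {P@(player k s)} {x} f nonLosing lost
      with lost-play {π = []} f tt (λ { (record { moves = [] }) () ; (record { moves = _ ∷ _ }) () }) lost refl refl
    ... | p , pl , coh , toMove , stuck = refute (nonLosing strategy (finite p) is)
      where
      -- The reply to f that follows p, the play on which P is stuck.
      open Advised (opponent P) x (λ π y → Prefix _≅_ (π ∷ʳ y) p)
        (λ rs → Prefix.trans ≅-trans (Prefix.fromPointwise
          (Pointwise-∷ʳ (Pointwise.symmetric ≅-sym rs) ≅-refl)))

      is : finite p Is f * strategy
      is = record
        { isPlay    = pl
        ; coherent  = coh
        ; coherent′ = λ π πy≼p z≡ → choose-good π z≡
            (subst (λ K → _ ∈[ K ] end x (moves π)) (FPlay.toMove π)
              (proj₂ (IsFinitePlay-∷ʳ⁻ (moves π) (IsFinitePlay-prefix ≅-refl πy≼p pl))))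
            πy≼p
        ; maximal   = maximal
        }
        where
        maximal : ∀ q → IsPlay s x q → Coherent q f → Coherent q strategy →
                  finite p ⊑ q → q ⊑ finite p
        -- A prefix of `q` going beyond `p` would need a move of `P` at the end of `p`, where there
        -- is none.
        maximal q q-play _ _ p⊑q π π≼q with ≼-comparable q π p π≼q (p⊑q p Prefix-refl)
        ... | inj₁ π≼p        = π≼p
        ... | inj₂ (y , py≼π) = contradiction
          (subst (λ K → y ∈[ K ] end x p) toMove
            (proj₂ (IsFinitePlay-∷ʳ⁻ p (IsFinitePlay-prefix ≅-refl py≼π (IsPlay-prefix q q-play π≼q)))))
          (stuck y)

      refute : ¬ NonLosingPlay k s x (finite p)
      refute (inj₁ (eq , _)) = opp-irrefl (trans (sym eq) toMove)
      refute (inj₂ ())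

    -- Contextual equivalence

    survives⇔hasNonLosing : ∀ Q → HasNonLosingStrategy Q x ⇔
      (Survives (proj₁ (components Q)) x × Survives (proj₂ (components Q)) x)
    survives⇔hasNonLosing Q = mk⇔
      (λ ((f , g) , nf , ng) → nonLosing⇒survives f nf , nonLosing⇒survives g ng)
      (λ (sf , sg) → let f , nf = survives⇒nonLosing sf ; g , ng = survives⇒nonLosing sg
                     in (f , g) , nf , ng)

    ≈⇒⊴ : ((x , p) (y , q) : 𝒢) → x ≈ y → ∀ k → q ⊴[ k ] p
    ≈⇒⊴ (x , p) (y , q) x≈y k = stable (survives k ∘ ⋬⇒Lost-difference p q)
      where
      y-y : Survives LII (y + - y) × Survives RII (y + - y)
      y-y = (λ l → mirror-survives l refl ≅-refl) , (λ l → mirror-survives l refl ≅-refl)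
      open Equivalence
      -- Role II comprises `LII` and `RII`, so this one instance of equideterminacy yields the
      -- inequality for both sides.
      x-y : Survives LII (x + - y) × Survives RII (x + - y)
      x-y = to (survives⇔hasNonLosing II)
              (from (x≈y (hole +ʳ (- y)) II) (from (survives⇔hasNonLosing II) y-y))
      survives : ∀ k → ¬ Lost k (opp k) (x + - y)
      survives left  = proj₁ x-y
      survives right = proj₂ x-y

    survives-context : (p : Conway x) (q : Conway y) → (∀ k → p ⊴[ k ] q) →
                       ∀ C P → Survives P (C [ x ]) → Survives P (C [ y ])
    survives-context p q p⊴q C P survives l =
      let _ , C≅ = context-as-sum C
      in survives (Lost-resp (≅-sym (C≅ _)) (Lost-antitone p q (p⊴q (side P)) l (C≅ _)))

    ⊴⇒≈ : (p : Conway x) (q : Conway y) → (∀ k → p ⊴[ k ] q) → (∀ k → q ⊴[ k ] p) → x ≈ y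
    ⊴⇒≈ p q p⊴q q⊴p C Q = mk⇔ (transfer p q p⊴q) (transfer q p q⊴p)
      where
      open Equivalence
      transfer : (p : Conway u) (q : Conway v) → (∀ k → p ⊴[ k ] q) →
                 HasNonLosingStrategy Q (C [ u ]) → HasNonLosingStrategy Q (C [ v ])
      transfer p q p⊴q h =
        let s₁ , s₂ = to (survives⇔hasNonLosing Q) h
        in from (survives⇔hasNonLosing Q)
             (survives-context p q p⊴q C _ s₁ , survives-context p q p⊴q C _ s₂)

theorem4p4 : ExcludedMiddle (suc 0ℓ) → Extensionality (suc 0ℓ) (suc 0ℓ) →
    ∀ (x y : 𝒢) → (proj₁ x ≈ proj₁ y) ⇔ (x ∼ y)
theorem4p4 em ext (x , p) (y , q) = mk⇔
  -- `_⊴[_]_` reads `geq` in opposite directions for the two sides, so `q ⊴[ k ] p` for both `k`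
  -- amounts to `x ∼ y`.
  (λ x≈y → let q⊴p = ≈⇒⊴ em ext (x , p) (y , q) x≈y in q⊴p left , q⊴p right)
  (λ (x≳y , y≳x) → ⊴⇒≈ em ext p q
    (λ { left → y≳x ; right → x≳y }) (λ { left → x≳y ; right → y≳x }))
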